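{- Let $D=(V,E)$ be an oriented graph whose vertex set $V(D)$ has a partition $(A,B)$ such that $B$ is an independent set and $D[A]$ is 2-degenerate. Then $D$ has a vertex with a large second neighborhood.
   Context: All graphs are finite and simple, with nonempty vertex set. An oriented graph is a digraph without loops or digons (an orientation of a simple undirected graph). $N_D^+(v)$ and $N_D^-(v)$ are the out- and in-neighborhoods of $v$; $N_D^{++}(v)=\{u\in V(D)\setminus(\{v\}\cup N_D^+(v)) : N_D^-(u)\cap N_D^+(v)\neq\emptyset\}$ is the second out-neighborhood. A vertex $v$ has a large second neighborhood in $D$ if $|N_D^{++}(v)|\ge |N_D^+(v)|$. $D[A]$ is the subgraph induced by $A$. An undirected graph is 2-degenerate if every subgraph of it has a vertex of degree at most two; an oriented graph is 2-degenerate if its underlying undirected graph is. A set of vertices is independent if there are no arcs between its members. Either part of the partition may be empty. -}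

module Defs where

open import Data.Fin.Base using (Fin)
open import Data.Fin.Subset
open import Data.Fin.Subset.Properties using (_∈?_; nonempty?)
open import Data.Nat.Base using (ℕ; _≤_)
open import Data.Product.Base using (_×_; _,_; ∃-syntax)
open import Data.Sum.Base using (_⊎_; inj₁; inj₂; swap; [_,_])
open import Data.Vec.Base using (tabulate)
open import Level using (0ℓ)
open import Relation.Binary.Core using (Rel; _⇒_)
open import Relation.Binary.Definitions using (Decidable; Symmetric; Asymmetric; Irreflexive)
open import Relation.Binary.PropositionalEquality.Core using (_≡_)
open import Relation.Nullary using (¬_)
open import Relation.Nullary.Decidable.Core using (does; _×-dec_; _⊎-dec_)
import Relation.Unary as U

comprehension : ∀ {n} {P : U.Pred (Fin n) 0ℓ} → U.Decidable P → Subset n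
comprehension P? = tabulate (λ u → does (P? u))

-- Graphs live on a set of vertices inside an ambient finite set Fin n, so that
-- a graph and its subgraphs have the same type.  The records admit the graph
-- without vertices (needed for induced D A with A empty); nonemptiness is a
-- separate hypothesis where a graph is quantified over.

record OrientedGraph (n : ℕ) : Set₁ where
  infix 4 _⟶_ _⟶?_
  field
    vertices  : Subset n
    _⟶_       : Rel (Fin n) 0ℓ
    _⟶?_      : Decidable _⟶_
    endpoints : ∀ {u v} → u ⟶ v → u ∈ vertices × v ∈ vertices
    loopless  : Irreflexive _≡_ _⟶_
    digonless : Asymmetric _⟶_

  N⁺ : Fin n → Subset n
  N⁺ v = comprehension (λ u → v ⟶? u)

  N⁻ : Fin n → Subset n
  N⁻ v = comprehension (λ u → u ⟶? v)

  N⁺⁺ : Fin n → Subset n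
  N⁺⁺ v = comprehension (λ u →
    (u ∈? vertices ─ (⁅ v ⁆ ∪ N⁺ v)) ×-dec nonempty? (N⁻ u ∩ N⁺ v))

  LargeSecondNeighborhood : Fin n → Set
  LargeSecondNeighborhood v = ∣ N⁺ v ∣ ≤ ∣ N⁺⁺ v ∣

  Independent : Subset n → Set
  Independent S = ∀ {u v} → u ∈ S → v ∈ S → ¬ (u ⟶ v)

record SimpleGraph (n : ℕ) : Set₁ where
  infix 4 _~_ _~?_
  field
    vertices  : Subset n
    _~_       : Rel (Fin n) 0ℓ
    _~?_      : Decidable _~_
    endpoints : ∀ {u v} → u ~ v → u ∈ vertices × v ∈ vertices
    loopless  : Irreflexive _≡_ _~_
    symmetric : Symmetric _~_

  degree : Fin n → ℕ
  degree v = ∣ comprehension (λ u → v ~? u) ∣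

-- Not necessarily induced.
IsSubgraph : ∀ {n} → SimpleGraph n → SimpleGraph n → Set
IsSubgraph H G = H.vertices ⊆ G.vertices × H._~_ ⇒ G._~_
  where
  module H = SimpleGraph H
  module G = SimpleGraph G

Degenerate : ∀ {n} → ℕ → SimpleGraph n → Set₁
Degenerate {n} d G =
  (H : SimpleGraph n) → IsSubgraph H G → Nonempty (SimpleGraph.vertices H) →
  ∃[ v ] v ∈ SimpleGraph.vertices H × SimpleGraph.degree H v ≤ d

underlying : ∀ {n} → OrientedGraph n → SimpleGraph n
underlying D = record
  { vertices  = vertices
  ; _~_       = λ u v → u ⟶ v ⊎ v ⟶ u
  ; _~?_      = λ u v → (u ⟶? v) ⊎-dec (v ⟶? u)
  ; endpoints = λ { (inj₁ a) → endpoints a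
                  ; (inj₂ a) → let (v∈ , u∈) = endpoints a in u∈ , v∈ }
  ; loopless  = λ { _≡_.refl → [ loopless _≡_.refl , loopless _≡_.refl ] }
  ; symmetric = swap
  }
  where open OrientedGraph D

TwoDegenerate : ∀ {n} → OrientedGraph n → Set₁
TwoDegenerate D = Degenerate 2 (underlying D)

-- Used only for A ⊆ vertices D.
induced : ∀ {n} → OrientedGraph n → Subset n → OrientedGraph n
induced D A = record
  { vertices  = A
  ; _⟶_       = λ u v → u ∈ A × v ∈ A × u ⟶ v
  ; _⟶?_      = λ u v → (u ∈? A) ×-dec (v ∈? A) ×-dec (u ⟶? v)
  ; endpoints = λ (u∈A , v∈A , _) → u∈A , v∈A
  ; loopless  = λ u≡v (_ , _ , a) → loopless u≡v a
  ; digonless = λ (_ , _ , a) (_ , _ , b) → digonless a b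
  }
  where open OrientedGraph D hiding (vertices)

-- An ordered partition of S into two possibly empty parts.
IsPartition : ∀ {n} → Subset n → Subset n → Subset n → Set
IsPartition S A B = A ∪ B ≡ S × A ∩ B ≡ ⊥

{-# OPTIONS --safe #-}
module Submission where

-- Suppose no vertex is large, let v have minimum out-degree d, and put
-- S = N⁺ v, W = N⁺⁺ v, so |W| < d.  Out-neighbours of S lie in S ∪ W, and a
-- 2-degenerate graph on m ≥ 2 vertices has at most 2m − 3 edges.
--
-- If S ⊆ A, counting the at least d² arcs leaving S gives W ⊆ B.  Some u ∈ S
-- has only one out-neighbour s in S, whence N⁺ u = W ∪ {s}.  An arc s → w with
-- w ∈ W would put N⁺ w inside N⁺⁺ u, making u large; so N⁺ s ⊆ S ∖ {s}, which
-- is too small.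
--
-- If S meets B, the first case shows that every vertex of B has out-degree at
-- least d + 1.  This bounds the number of arcs from S ∩ A to S ∩ B, and
-- counting the at least |S ∩ A| · d arcs leaving S ∩ A is contradictory.

open import Defs
open import Data.Bool.Base using (if_then_else_)
open import Data.Empty using (⊥-elim)
open import Data.Fin.Base using (Fin; zero; suc)
open import Data.Fin.Properties using (any?)
import Data.Fin.Properties as Fin
open import Data.Fin.Subset
open import Data.Fin.Subset.Properties
open import Data.Nat.Base using (ℕ; zero; suc; _+_; _*_; _∸_; _⊓_; _≤_; _<_; z≤n; s≤s)
open import Data.Nat.Induction using (<-wellFounded)
open import Data.Nat.Properties
open import Data.Nat.Tactic.RingSolver using (solve-∀)
open import Data.Product.Base using (_×_; _,_; proj₁; proj₂; ∃-syntax)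
open import Data.Sum.Base as Sum using (_⊎_; inj₁; inj₂)
open import Data.Vec.Base using ([]; _∷_; lookup; here; there)
open import Data.Vec.Properties using (lookup∘tabulate; []=⇒lookup; lookup⇒[]=)
open import Function.Base using (_∘_; _$_; case_of_)
open import Induction.WellFounded using (Acc; acc)
open import Level using (0ℓ)
open import Relation.Binary.PropositionalEquality
open import Relation.Nullary using (¬_; yes; no)
open import Relation.Nullary.Decidable using (does; dec-true; _×-dec_; decidable-stable)
import Relation.Unary as U

private
  variable
    n : ℕ

-- Subsets cut out by decidable predicates, and cardinality estimates.

module _ {P : U.Pred (Fin n) 0ℓ} (P? : U.Decidable P) where

  ∈-comprehension⁺ : ∀ {x} → P x → x ∈ comprehension P?
  ∈-comprehension⁺ {x} px =
    lookup⇒[]= x _ (trans (lookup∘tabulate _ x) (dec-true (P? x) px))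

  ∈-comprehension⁻ : ∀ {x} → x ∈ comprehension P? → P x
  ∈-comprehension⁻ {x} x∈ with P? x | trans (sym (lookup∘tabulate (does ∘ P?) x)) ([]=⇒lookup x∈)
  ... | yes px | _ = px
  ... | no _   | ()

∣p∪q∣≤∣p∣+∣q∣ : ∀ (p q : Subset n) → ∣ p ∪ q ∣ ≤ ∣ p ∣ + ∣ q ∣
∣p∪q∣≤∣p∣+∣q∣ []            []            = z≤n
∣p∪q∣≤∣p∣+∣q∣ (inside  ∷ p) (inside  ∷ q) = s≤s $
  ≤-trans (∣p∪q∣≤∣p∣+∣q∣ p q) (+-monoʳ-≤ ∣ p ∣ (n≤1+n _))
∣p∪q∣≤∣p∣+∣q∣ (inside  ∷ p) (outside ∷ q) = s≤s (∣p∪q∣≤∣p∣+∣q∣ p q)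
∣p∪q∣≤∣p∣+∣q∣ (outside ∷ p) (inside  ∷ q) =
  subst (suc ∣ p ∪ q ∣ ≤_) (sym (+-suc ∣ p ∣ ∣ q ∣)) (s≤s (∣p∪q∣≤∣p∣+∣q∣ p q))
∣p∪q∣≤∣p∣+∣q∣ (outside ∷ p) (outside ∷ q) = ∣p∪q∣≤∣p∣+∣q∣ p q

disjoint⇒∣p∣+∣q∣≤∣p∪q∣ : ∀ (p q : Subset n) → (∀ {x} → x ∈ p → x ∉ q) → ∣ p ∣ + ∣ q ∣ ≤ ∣ p ∪ q ∣
disjoint⇒∣p∣+∣q∣≤∣p∪q∣ []            []            _   = z≤n
disjoint⇒∣p∣+∣q∣≤∣p∪q∣ (inside  ∷ p) (inside  ∷ q) p∩q = ⊥-elim (p∩q here here)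
disjoint⇒∣p∣+∣q∣≤∣p∪q∣ (inside  ∷ p) (outside ∷ q) p∩q =
  s≤s (disjoint⇒∣p∣+∣q∣≤∣p∪q∣ p q λ x∈p x∈q → p∩q (there x∈p) (there x∈q))
disjoint⇒∣p∣+∣q∣≤∣p∪q∣ (outside ∷ p) (inside  ∷ q) p∩q =
  subst (_≤ suc ∣ p ∪ q ∣) (sym (+-suc ∣ p ∣ ∣ q ∣))
    (s≤s (disjoint⇒∣p∣+∣q∣≤∣p∪q∣ p q λ x∈p x∈q → p∩q (there x∈p) (there x∈q)))
disjoint⇒∣p∣+∣q∣≤∣p∪q∣ (outside ∷ p) (outside ∷ q) p∩q =
  disjoint⇒∣p∣+∣q∣≤∣p∪q∣ p q λ x∈p x∈q → p∩q (there x∈p) (there x∈q)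

∣∣-cover : ∀ {p q r : Subset n} → (∀ {x} → x ∈ p → x ∈ q ⊎ x ∈ r) → ∣ p ∣ ≤ ∣ q ∣ + ∣ r ∣
∣∣-cover {q = q} {r} cov =
  ≤-trans (p⊆q⇒∣p∣≤∣q∣ λ x∈p → x∈p∪q⁺ (cov x∈p)) (∣p∪q∣≤∣p∣+∣q∣ q r)

∣∣-pack : ∀ {p q r : Subset n} → p ⊆ r → q ⊆ r → (∀ {x} → x ∈ p → x ∉ q) → ∣ p ∣ + ∣ q ∣ ≤ ∣ r ∣
∣∣-pack {p = p} {q} {r} p⊆r q⊆r disj =
  ≤-trans (disjoint⇒∣p∣+∣q∣≤∣p∪q∣ p q disj) (p⊆q⇒∣p∣≤∣q∣ sub)
  where
  sub : p ∪ q ⊆ r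
  sub x∈ with x∈p∪q⁻ p q x∈
  ... | inj₁ x∈p = p⊆r x∈p
  ... | inj₂ x∈q = q⊆r x∈q

∣p∣≤1+∣p-x∣ : ∀ (p : Subset n) x → ∣ p ∣ ≤ 1 + ∣ p - x ∣
∣p∣≤1+∣p-x∣ p x =
  subst (λ k → ∣ p ∣ ≤ k + ∣ p - x ∣) (∣⁅x⁆∣≡1 x) (∣∣-cover {q = ⁅ x ⁆} split)
  where
  split : ∀ {y} → y ∈ p → y ∈ ⁅ x ⁆ ⊎ y ∈ p - x
  split {y} y∈p with y Fin.≟ x
  ... | yes refl = inj₁ (x∈⁅x⁆ y)
  ... | no  y≢x  = inj₂ (x∈p∧x≢y⇒x∈p-y y∈p y≢x)

x∈p⇒∣p∣≡1+∣p-x∣ : ∀ {p : Subset n} {x} → x ∈ p → ∣ p ∣ ≡ 1 + ∣ p - x ∣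
x∈p⇒∣p∣≡1+∣p-x∣ {p = p} {x} x∈p = ≤-antisym (∣p∣≤1+∣p-x∣ p x) (x∈p⇒∣p-x∣<∣p∣ x∈p)

1≤∣p∣⇒Nonempty : ∀ (p : Subset n) → 1 ≤ ∣ p ∣ → Nonempty p
1≤∣p∣⇒Nonempty (inside  ∷ p) _  = zero , here
1≤∣p∣⇒Nonempty (outside ∷ p) le = let (x , x∈p) = 1≤∣p∣⇒Nonempty p le in suc x , there x∈p

x∈p⇒1≤∣p∣ : ∀ {p : Subset n} {x} → x ∈ p → 1 ≤ ∣ p ∣
x∈p⇒1≤∣p∣ x∈p = ≤-trans (s≤s z≤n) (x∈p⇒∣p-x∣<∣p∣ x∈p)

-- Finite sums over subsets, and minimisers.

∑ : Subset n → (Fin n → ℕ) → ℕ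
∑ []            f = 0
∑ (inside  ∷ p) f = f zero + ∑ p (f ∘ suc)
∑ (outside ∷ p) f = ∑ p (f ∘ suc)

∑-mono : ∀ (p : Subset n) {f g} → (∀ {x} → x ∈ p → f x ≤ g x) → ∑ p f ≤ ∑ p g
∑-mono []            f≤g = z≤n
∑-mono (inside  ∷ p) f≤g = +-mono-≤ (f≤g here) (∑-mono p (f≤g ∘ there))
∑-mono (outside ∷ p) f≤g = ∑-mono p (f≤g ∘ there)

∑-cong : ∀ (p : Subset n) {f g} → (∀ x → f x ≡ g x) → ∑ p f ≡ ∑ p g
∑-cong []            f≡g = refl
∑-cong (inside  ∷ p) f≡g = cong₂ _+_ (f≡g zero) (∑-cong p (f≡g ∘ suc))
∑-cong (outside ∷ p) f≡g = ∑-cong p (f≡g ∘ suc)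

∑-⊆ : ∀ {p q : Subset n} f → p ⊆ q → ∑ p f ≤ ∑ q f
∑-⊆ {p = []}          {[]}          f p⊆q = z≤n
∑-⊆ {p = outside ∷ p} {outside ∷ q} f p⊆q = ∑-⊆ (f ∘ suc) (drop-∷-⊆ p⊆q)
∑-⊆ {p = outside ∷ p} {inside  ∷ q} f p⊆q = m≤n⇒m≤o+n (f zero) (∑-⊆ (f ∘ suc) (drop-∷-⊆ p⊆q))
∑-⊆ {p = inside  ∷ p} {inside  ∷ q} f p⊆q = +-monoʳ-≤ (f zero) (∑-⊆ (f ∘ suc) (drop-∷-⊆ p⊆q))
∑-⊆ {p = inside  ∷ p} {outside ∷ q} f p⊆q with () ← p⊆q here

∑-const : ∀ (p : Subset n) c → ∑ p (λ _ → c) ≡ ∣ p ∣ * c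
∑-const []            c = refl
∑-const (inside  ∷ p) c = cong (c +_) (∑-const p c)
∑-const (outside ∷ p) c = ∑-const p c

∑-distrib-+ : ∀ (p : Subset n) f g → ∑ p (λ x → f x + g x) ≡ ∑ p f + ∑ p g
∑-distrib-+ []            f g = refl
∑-distrib-+ (outside ∷ p) f g = ∑-distrib-+ p (f ∘ suc) (g ∘ suc)
∑-distrib-+ (inside  ∷ p) f g
  rewrite ∑-distrib-+ p (f ∘ suc) (g ∘ suc) = interchange (f zero) (g zero) _ _
  where
  interchange : ∀ a b c d → a + b + (c + d) ≡ a + c + (b + d)
  interchange = solve-∀

∑-remove : ∀ {p : Subset n} {x} f → x ∈ p → ∑ p f ≡ f x + ∑ (p - x) f
-- The tail of `⁅ zero ⁆` is `⊥`, so removing `zero` leaves `p ─ ⊥` on the tail.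
∑-remove {p = inside  ∷ p} f here        = cong (λ q → f zero + ∑ q (f ∘ suc)) (sym (p─⊥≡p p))
∑-remove {p = outside ∷ p} f (there x∈p) = ∑-remove (f ∘ suc) x∈p
∑-remove {p = inside  ∷ p} {suc x} f (there x∈p) rewrite ∑-remove (f ∘ suc) x∈p =
  exchange (f zero) (f (suc x)) _
  where
  exchange : ∀ a b c → a + (b + c) ≡ b + (a + c)
  exchange = solve-∀

∑-comm : ∀ {m} (p : Subset n) (q : Subset m) (f : Fin n → Fin m → ℕ) →
  ∑ p (λ x → ∑ q (f x)) ≡ ∑ q (λ y → ∑ p (λ x → f x y))
∑-comm []            q f = sym (trans (∑-const q 0) (*-zeroʳ ∣ q ∣))
∑-comm (outside ∷ p) q f = ∑-comm p q (f ∘ suc)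
∑-comm (inside  ∷ p) q f = trans
  (cong (∑ q (f zero) +_) (∑-comm p q (f ∘ suc)))
  (sym (∑-distrib-+ q (f zero) (λ y → ∑ p (λ x → f (suc x) y))))

-- Turns cardinalities into sums of zeros and ones, so that `∑-comm` can count arcs by tail or by
-- head.
∑-indicator : ∀ (p q : Subset n) →
  ∑ q (λ x → if lookup p x then 1 else 0) ≡ ∣ p ∩ q ∣
∑-indicator []            []            = refl
∑-indicator (inside  ∷ p) (inside  ∷ q) = cong suc (∑-indicator p q)
∑-indicator (outside ∷ p) (inside  ∷ q) = ∑-indicator p q
∑-indicator (inside  ∷ p) (outside ∷ q) = ∑-indicator p q
∑-indicator (outside ∷ p) (outside ∷ q) = ∑-indicator p q

-- Descent: as long as some element of `p` has a smaller value, move to it; well-foundedness of `<`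
-- on the values ends this.
argmin : ∀ {p : Subset n} (f : Fin n → ℕ) → Nonempty p →
  ∃[ v ] v ∈ p × (∀ {u} → u ∈ p → f v ≤ f u)
argmin {p = p} f (v₀ , v₀∈p) = go v₀ v₀∈p (<-wellFounded (f v₀))
  where
  go : ∀ v → v ∈ p → Acc _<_ (f v) → ∃[ v ] v ∈ p × (∀ {u} → u ∈ p → f v ≤ f u)
  go v v∈p (acc rec) with any? (λ u → (u ∈? p) ×-dec (f u <? f v))
  ... | yes (u , u∈p , fu<fv) = go u u∈p (rec fu<fv)
  ... | no  none = v , v∈p , λ {u} u∈p → ≮⇒≥ λ fu<fv → none (u , u∈p , fu<fv)

-- Removing a vertex of degree at most 2 from 1 + k vertices loses at most
-- 2 ⊓ k edges; the minimum is what improves 2m to 2m − 3.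
maxArcs : ℕ → ℕ
maxArcs zero    = 0
maxArcs (suc k) = 2 ⊓ k + maxArcs k

maxArcs-closed : ∀ k → maxArcs (2 + k) + 3 ≡ 2 * (2 + k)
maxArcs-closed zero    = refl
maxArcs-closed (suc k) = trans (cong (2 +_) (maxArcs-closed k)) (lemma k)
  where
  lemma : ∀ k → 2 + 2 * (2 + k) ≡ 2 * (3 + k)
  lemma = solve-∀

-- Second neighbourhoods and arc counts.

module _ {n} (D : OrientedGraph n) where
  open OrientedGraph D

  ⟶⇒∈N⁺ : ∀ {v u} → v ⟶ u → u ∈ N⁺ v
  ⟶⇒∈N⁺ {v} = ∈-comprehension⁺ (v ⟶?_)

  ∈N⁺⇒⟶ : ∀ {v u} → u ∈ N⁺ v → v ⟶ u
  ∈N⁺⇒⟶ {v} = ∈-comprehension⁻ (v ⟶?_)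

  ⟶⇒∈N⁻ : ∀ {v u} → u ⟶ v → u ∈ N⁻ v
  ⟶⇒∈N⁻ {v} = ∈-comprehension⁺ (_⟶? v)

  ∈N⁻⇒⟶ : ∀ {v u} → u ∈ N⁻ v → u ⟶ v
  ∈N⁻⇒⟶ {v} = ∈-comprehension⁻ (_⟶? v)

  N⁺⁺? : ∀ v → U.Decidable (λ u → u ∈ vertices ─ (⁅ v ⁆ ∪ N⁺ v) × Nonempty (N⁻ u ∩ N⁺ v))
  N⁺⁺? v u = (u ∈? vertices ─ (⁅ v ⁆ ∪ N⁺ v)) ×-dec nonempty? (N⁻ u ∩ N⁺ v)

  -- That `y` differs from `v` comes for free: otherwise `v` and `u` would span a digon.
  ∈N⁺⁺ : ∀ {v u y} → v ⟶ u → u ⟶ y → ¬ v ⟶ y → y ∈ N⁺⁺ v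
  ∈N⁺⁺ {v} {u} {y} vu uy ¬vy =
    ∈-comprehension⁺ (N⁺⁺? v)
      ( x∈p∧x∉q⇒x∈p─q (proj₂ (endpoints uy)) y∉
      , u , x∈p∩q⁺ (⟶⇒∈N⁻ uy , ⟶⇒∈N⁺ vu))
    where
    y∉ : y ∉ ⁅ v ⁆ ∪ N⁺ v
    y∉ y∈ with x∈p∪q⁻ ⁅ v ⁆ (N⁺ v) y∈
    ... | inj₁ y∈v with refl ← x∈⁅y⁆⇒x≡y v y∈v = ⊥-elim (digonless vu uy)
    ... | inj₂ y∈N = ¬vy (∈N⁺⇒⟶ y∈N)

  N⁺⊆N⁺∪N⁺⁺ : ∀ {v u y} → v ⟶ u → u ⟶ y → y ∈ N⁺ v ⊎ y ∈ N⁺⁺ v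
  N⁺⊆N⁺∪N⁺⁺ {v} {u} {y} vu uy with v ⟶? y
  ... | yes vy = inj₁ (⟶⇒∈N⁺ vy)
  ... | no ¬vy = inj₂ (∈N⁺⁺ vu uy ¬vy)

  N⁺⁺⊆vertices : ∀ {v y} → y ∈ N⁺⁺ v → y ∈ vertices
  N⁺⁺⊆vertices {v} y∈ = p─q⊆p vertices (⁅ v ⁆ ∪ N⁺ v) (proj₁ (∈-comprehension⁻ (N⁺⁺? v) y∈))

  #arcs : Subset n → Subset n → ℕ
  #arcs P Q = ∑ P (λ u → ∣ N⁺ u ∩ Q ∣)

  -- Double counting: sum the 0-1 adjacency matrix by rows, then by columns.
  #arcs-in : ∀ P Q → #arcs P Q ≡ ∑ Q (λ u → ∣ N⁻ u ∩ P ∣)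
  #arcs-in P Q = begin
    ∑ P (λ u → ∣ N⁺ u ∩ Q ∣)                                  ≡⟨ ∑-cong P (λ u → ∑-indicator (N⁺ u) Q) ⟨
    ∑ P (λ u → ∑ Q λ w → if lookup (N⁺ u) w then 1 else 0)    ≡⟨ ∑-comm P Q _ ⟩
    ∑ Q (λ w → ∑ P λ u → if lookup (N⁺ u) w then 1 else 0)    ≡⟨ ∑-cong Q (λ w → ∑-cong P λ u → cong (if_then 1 else 0) (same u w)) ⟩
    ∑ Q (λ w → ∑ P λ u → if lookup (N⁻ w) u then 1 else 0)    ≡⟨ ∑-cong Q (λ w → ∑-indicator (N⁻ w) P) ⟩
    ∑ Q (λ w → ∣ N⁻ w ∩ P ∣)                                  ∎
    where
    open ≡-Reasoning
    same : ∀ u w → lookup (N⁺ u) w ≡ lookup (N⁻ w) u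
    same u w = trans (lookup∘tabulate (λ y → does (u ⟶? y)) w)
                     (sym (lookup∘tabulate (λ y → does (y ⟶? w)) u))

  #arcs-mono : ∀ {P P′ Q Q′} → P ⊆ P′ → Q ⊆ Q′ → #arcs P Q ≤ #arcs P′ Q′
  #arcs-mono {P} {P′} {Q} {Q′} P⊆ Q⊆ = ≤-trans (∑-⊆ _ P⊆)
    (∑-mono P′ λ {u} _ → p⊆q⇒∣p∣≤∣q∣ λ x∈ →
      let (x∈N , x∈Q) = x∈p∩q⁻ (N⁺ u) Q x∈ in x∈p∩q⁺ (x∈N , Q⊆ x∈Q))

  #arcs-≤-* : ∀ P Q → #arcs P Q ≤ ∣ P ∣ * ∣ Q ∣
  #arcs-≤-* P Q = ≤-trans (∑-mono P λ {u} _ → ∣p∩q∣≤∣q∣ (N⁺ u) Q) (≤-reflexive (∑-const P ∣ Q ∣))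

  -- An arc inside `X` leaves `v`, enters `v` or avoids `v`.
  #arcs-remove : ∀ {X v} → v ∈ X →
    #arcs X X ≤ ∣ N⁺ v ∩ X ∣ + ∣ N⁻ v ∩ X ∣ + #arcs (X - v) (X - v)
  #arcs-remove {X} {v} v∈X = begin
    #arcs X X
      ≡⟨ ∑-remove _ v∈X ⟩
    ∣ N⁺ v ∩ X ∣ + #arcs X′ X
      ≤⟨ +-monoʳ-≤ ∣ N⁺ v ∩ X ∣ (∑-mono X′ λ {u} _ → ∣∣-cover (split u)) ⟩
    ∣ N⁺ v ∩ X ∣ + ∑ X′ (λ u → ∣ N⁺ u ∩ ⁅ v ⁆ ∣ + ∣ N⁺ u ∩ X′ ∣)
      ≡⟨ cong (∣ N⁺ v ∩ X ∣ +_) (∑-distrib-+ X′ _ _) ⟩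
    ∣ N⁺ v ∩ X ∣ + (#arcs X′ ⁅ v ⁆ + #arcs X′ X′)
      ≤⟨ +-monoʳ-≤ ∣ N⁺ v ∩ X ∣ (+-monoˡ-≤ (#arcs X′ X′) toV) ⟩
    ∣ N⁺ v ∩ X ∣ + (∣ N⁻ v ∩ X ∣ + #arcs X′ X′)
      ≡⟨ +-assoc ∣ N⁺ v ∩ X ∣ _ _ ⟨
    ∣ N⁺ v ∩ X ∣ + ∣ N⁻ v ∩ X ∣ + #arcs X′ X′ ∎
    where
    open ≤-Reasoning
    X′ : Subset n
    X′ = X - v

    split : ∀ u {x} → x ∈ N⁺ u ∩ X → x ∈ N⁺ u ∩ ⁅ v ⁆ ⊎ x ∈ N⁺ u ∩ X′
    split u {x} x∈ with x Fin.≟ v | x∈p∩q⁻ (N⁺ u) X x∈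
    ... | yes refl | x∈N , _   = inj₁ (x∈p∩q⁺ (x∈N , x∈⁅x⁆ x))
    ... | no  x≢v  | x∈N , x∈X = inj₂ (x∈p∩q⁺ (x∈N , x∈p∧x≢y⇒x∈p-y x∈X x≢v))

    toV : #arcs X′ ⁅ v ⁆ ≤ ∣ N⁻ v ∩ X ∣
    toV = begin
      #arcs X′ ⁅ v ⁆                          ≡⟨ #arcs-in X′ ⁅ v ⁆ ⟩
      ∑ ⁅ v ⁆ (λ w → ∣ N⁻ w ∩ X′ ∣)           ≤⟨ ∑-mono ⁅ v ⁆ inV ⟩
      ∑ ⁅ v ⁆ (λ _ → ∣ N⁻ v ∩ X ∣)            ≡⟨ ∑-const ⁅ v ⁆ _ ⟩
      ∣ ⁅ v ⁆ ∣ * ∣ N⁻ v ∩ X ∣                ≡⟨ cong (_* ∣ N⁻ v ∩ X ∣) (∣⁅x⁆∣≡1 v) ⟩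
      1 * ∣ N⁻ v ∩ X ∣                        ≡⟨ *-identityˡ _ ⟩
      ∣ N⁻ v ∩ X ∣                            ∎
      where
      inV : ∀ {w} → w ∈ ⁅ v ⁆ → ∣ N⁻ w ∩ X′ ∣ ≤ ∣ N⁻ v ∩ X ∣
      inV w∈ with refl ← x∈⁅y⁆⇒x≡y v w∈ = p⊆q⇒∣p∣≤∣q∣ λ x∈ →
        let (x∈N , x∈X′) = x∈p∩q⁻ (N⁻ v) X′ x∈ in x∈p∩q⁺ (x∈N , p─q⊆p X ⁅ v ⁆ x∈X′)

  -- Sparsity of 2-degenerate graphs.

  module _ {A : Subset n} (deg : TwoDegenerate (induced D A)) where

    -- Degeneracy is applied to the subgraph induced on `X`. Without digons, in- and out-neighbours
    -- are disjoint, so their numbers add up to at most the degree; without loops, the neighbours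
    -- lie in `X - v`.
    sparse-vertex : ∀ {X} → X ⊆ A → Nonempty X →
      ∃[ v ] v ∈ X × ∣ N⁺ v ∩ X ∣ + ∣ N⁻ v ∩ X ∣ ≤ 2 ⊓ ∣ X - v ∣
    sparse-vertex {X} X⊆A ne =
      let (v , v∈X , d≤2) = deg H (X⊆A , H⊆) ne
      in v , v∈X , ⊓-glb (≤-trans (≤deg v v∈X) d≤2) (≤-trans (≤deg v v∈X) (deg≤ v))
      where
      H : SimpleGraph n
      H = underlying (induced D X)
      module H = SimpleGraph H

      H⊆ : ∀ {u v} → u H.~ v → SimpleGraph._~_ (underlying (induced D A)) u v
      H⊆ (inj₁ (u∈ , v∈ , uv)) = inj₁ (X⊆A u∈ , X⊆A v∈ , uv)
      H⊆ (inj₂ (u∈ , v∈ , uv)) = inj₂ (X⊆A u∈ , X⊆A v∈ , uv)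

      ≤deg : ∀ v → v ∈ X → ∣ N⁺ v ∩ X ∣ + ∣ N⁻ v ∩ X ∣ ≤ H.degree v
      ≤deg v v∈X = ∣∣-pack
        (λ x∈ → let (x∈N , x∈X) = x∈p∩q⁻ (N⁺ v) X x∈ in
          ∈-comprehension⁺ (λ u → v H.~? u) (inj₁ (v∈X , x∈X , ∈N⁺⇒⟶ x∈N)))
        (λ x∈ → let (x∈N , x∈X) = x∈p∩q⁻ (N⁻ v) X x∈ in
          ∈-comprehension⁺ (λ u → v H.~? u) (inj₂ (x∈X , v∈X , ∈N⁻⇒⟶ x∈N)))
        (λ x∈⁺ x∈⁻ → digonless
          (∈N⁺⇒⟶ (p∩q⊆p (N⁺ v) X x∈⁺))
          (∈N⁻⇒⟶ (p∩q⊆p (N⁻ v) X x∈⁻)))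

      deg≤ : ∀ v → H.degree v ≤ ∣ X - v ∣
      deg≤ v = p⊆q⇒∣p∣≤∣q∣ λ x∈ →
        let v~x = ∈-comprehension⁻ (λ u → v H.~? u) x∈ in
        x∈p∧x≢y⇒x∈p-y (proj₂ (H.endpoints v~x)) (λ x≡v → H.loopless (sym x≡v) v~x)

    -- Induction on the size of `X`, deleting a sparse vertex each time.
    #arcs-≤-maxArcs : ∀ k X → ∣ X ∣ ≡ k → X ⊆ A → #arcs X X ≤ maxArcs k
    #arcs-≤-maxArcs zero    X ∣X∣≡ X⊆A = ≤-trans (#arcs-≤-* X X) (≤-reflexive (cong (_* ∣ X ∣) ∣X∣≡))
    #arcs-≤-maxArcs (suc k) X ∣X∣≡ X⊆A
      with sparse-vertex X⊆A (1≤∣p∣⇒Nonempty X (subst (1 ≤_) (sym ∣X∣≡) (s≤s z≤n)))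
    ... | v , v∈X , few = ≤-trans (#arcs-remove v∈X) $
      +-mono-≤ (subst (λ j → _ ≤ 2 ⊓ j) ∣X′∣≡ few)
               (#arcs-≤-maxArcs k (X - v) ∣X′∣≡ (X⊆A ∘ p─q⊆p X ⁅ v ⁆))
      where
      ∣X′∣≡ : ∣ X - v ∣ ≡ k
      ∣X′∣≡ = suc-injective (trans (sym (x∈p⇒∣p∣≡1+∣p-x∣ v∈X)) ∣X∣≡)

    -- The bound 2m - 3, with the 3 moved across to avoid truncated subtraction. It fails for m ≤ 1.
    #arcs-sparse : ∀ {X} → X ⊆ A → 2 ≤ ∣ X ∣ → #arcs X X + 3 ≤ 2 * ∣ X ∣
    #arcs-sparse {X} X⊆A 2≤ with m≤n⇒∃[o]m+o≡n 2≤
    ... | k , 2+k≡ = begin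
      #arcs X X + 3        ≤⟨ +-monoˡ-≤ 3 (#arcs-≤-maxArcs (2 + k) X (sym 2+k≡) X⊆A) ⟩
      maxArcs (2 + k) + 3  ≡⟨ maxArcs-closed k ⟩
      2 * (2 + k)          ≡⟨ cong (2 *_) 2+k≡ ⟩
      2 * ∣ X ∣            ∎
      where open ≤-Reasoning

∣p∣≤1⇒x≡y : ∀ {p : Subset n} {x y} → ∣ p ∣ ≤ 1 → x ∈ p → y ∈ p → x ≡ y
∣p∣≤1⇒x≡y {p = p} {x} {y} ∣p∣≤1 x∈p y∈p with x Fin.≟ y
... | yes x≡y = x≡y
... | no  x≢y = ⊥-elim (<-irrefl refl (begin-strict
  1          ≤⟨ x∈p⇒1≤∣p∣ (x∈p∧x≢y⇒x∈p-y x∈p x≢y) ⟩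
  ∣ p - y ∣  <⟨ x∈p⇒∣p-x∣<∣p∣ y∈p ⟩
  ∣ p ∣      ≤⟨ ∣p∣≤1 ⟩
  1          ∎))
  where open ≤-Reasoning

-- Here `a`, `b`, `b + 1 + t` and `w` stand for the sizes of `S-A`, `S-B`, `W-A` and `W-B`, and
-- `b * t` for a bound on the arcs from `S-A` to `S-B`. The identity displays the slack as a
-- polynomial with nonnegative coefficients.
counting-bound : ∀ t b w k → let a = 2 + t + w + k in
  2 * (a + (b + 1 + t)) + b * t + a * w < a * (a + b) + 3
counting-bound t b w k = m+n≤o⇒m≤o _ (≤-reflexive (identity t b w k))
  where
  identity : ∀ t b w k → let a = 2 + t + w + k in
    suc (2 * (a + (b + 1 + t)) + b * t + a * w) + (t * (t + w + k) + a * k + (w + k) * b)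
      ≡ a * (a + b) + 3
  identity = solve-∀

-- A counterexample and its vertices of minimum out-degree.

module _ {n} (D : OrientedGraph n) {A B : Subset n} where
  open OrientedGraph D

  module _ (A∪B : IsPartition vertices A B) (indep : Independent B)
           (deg : TwoDegenerate (induced D A))
           (small : ∀ {v} → v ∈ vertices → ∣ N⁺⁺ v ∣ < ∣ N⁺ v ∣) where

    part : ∀ {x} → x ∈ vertices → x ∈ A ⊎ x ∈ B
    part x∈ = x∈p∪q⁻ A B (subst (_ ∈_) (sym (proj₁ A∪B)) x∈)

    A∩B : ∀ {x} → x ∈ A → x ∉ B
    A∩B x∈A x∈B = ∉⊥ (subst (_ ∈_) (proj₂ A∪B) (x∈p∩q⁺ (x∈A , x∈B)))

    B⟶A : ∀ {x y} → x ∈ B → x ⟶ y → y ∈ A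
    B⟶A x∈B xy with part (proj₂ (endpoints xy))
    ... | inj₁ y∈A = y∈A
    ... | inj₂ y∈B = ⊥-elim (indep x∈B y∈B xy)

    module _ {v} (v∈ : v ∈ vertices) (minimal : ∀ {u} → u ∈ vertices → ∣ N⁺ v ∣ ≤ ∣ N⁺ u ∣) where

      private
        S W S-A S-B W-A W-B : Subset n
        S   = N⁺ v
        W   = N⁺⁺ v
        S-A = S ∩ A
        S-B = S ∩ B
        W-A = W ∩ A
        W-B = W ∩ B

      S⊆vertices : S ⊆ vertices
      S⊆vertices = proj₂ ∘ endpoints ∘ ∈N⁺⇒⟶ D

      ∣S∣≡ : ∣ S ∣ ≡ ∣ S-A ∣ + ∣ S-B ∣
      ∣S∣≡ = ≤-antisym
        (∣∣-cover λ x∈ → map₁₂ x∈ (part (S⊆vertices x∈)))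
        (∣∣-pack (p∩q⊆p S A) (p∩q⊆p S B) λ x∈ x∈′ → A∩B (p∩q⊆q S A x∈) (p∩q⊆q S B x∈′))
        where
        map₁₂ : ∀ {x} → x ∈ S → x ∈ A ⊎ x ∈ B → x ∈ S-A ⊎ x ∈ S-B
        map₁₂ x∈S = Sum.map (λ x∈A → x∈p∩q⁺ (x∈S , x∈A)) (λ x∈B → x∈p∩q⁺ (x∈S , x∈B))

      ∣W∣≥ : ∣ W-A ∣ + ∣ W-B ∣ ≤ ∣ W ∣
      ∣W∣≥ = ∣∣-pack (p∩q⊆p W A) (p∩q⊆p W B) λ x∈ x∈′ → A∩B (p∩q⊆q W A x∈) (p∩q⊆q W B x∈′)

      -- By minimality each vertex of `S-A` has at least `∣ S ∣` out-neighbours, all in `S` or `W`.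
      -- Heads in `A` give arcs inside `S-A ∪ W-A`, bounded by sparsity; heads in `W-B` are bounded
      -- trivially; arcs to `S-B` are left for each case to bound.
      ∣S-A∣*∣S∣-bound : 2 ≤ ∣ S-A ∣ →
        ∣ S-A ∣ * ∣ S ∣ + 3 ≤ 2 * (∣ S-A ∣ + ∣ W-A ∣) + #arcs D S-A S-B + ∣ S-A ∣ * ∣ W-B ∣
      ∣S-A∣*∣S∣-bound 2≤ = begin
        ∣ S-A ∣ * ∣ S ∣ + 3
          ≡⟨ cong (_+ 3) (∑-const S-A ∣ S ∣) ⟨
        ∑ S-A (λ _ → ∣ S ∣) + 3
          ≤⟨ +-monoˡ-≤ 3 (∑-mono S-A out) ⟩
        ∑ S-A (λ u → ∣ N⁺ u ∩ P ∣ + (∣ N⁺ u ∩ S-B ∣ + ∣ N⁺ u ∩ W-B ∣)) + 3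
          ≡⟨ cong (_+ 3) (trans (∑-distrib-+ S-A _ _) (cong (#arcs D S-A P +_) (∑-distrib-+ S-A _ _))) ⟩
        #arcs D S-A P + (#arcs D S-A S-B + #arcs D S-A W-B) + 3
          ≤⟨ +-monoˡ-≤ 3 (+-mono-≤ (#arcs-mono D S-A⊆P ⊆-refl) (+-monoʳ-≤ (#arcs D S-A S-B) (#arcs-≤-* D S-A W-B))) ⟩
        #arcs D P P + (#arcs D S-A S-B + ∣ S-A ∣ * ∣ W-B ∣) + 3
          ≡⟨ shuffle (#arcs D P P) (#arcs D S-A S-B) (∣ S-A ∣ * ∣ W-B ∣) ⟩
        #arcs D P P + 3 + #arcs D S-A S-B + ∣ S-A ∣ * ∣ W-B ∣
          ≤⟨ +-monoˡ-≤ (∣ S-A ∣ * ∣ W-B ∣) (+-monoˡ-≤ (#arcs D S-A S-B)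
               (≤-trans (#arcs-sparse D deg P⊆A (≤-trans 2≤ (p⊆q⇒∣p∣≤∣q∣ S-A⊆P)))
                        (*-monoʳ-≤ 2 (∣p∪q∣≤∣p∣+∣q∣ S-A W-A)))) ⟩
        2 * (∣ S-A ∣ + ∣ W-A ∣) + #arcs D S-A S-B + ∣ S-A ∣ * ∣ W-B ∣ ∎
        where
        open ≤-Reasoning
        P : Subset n
        P = S-A ∪ W-A

        S-A⊆P : S-A ⊆ P
        S-A⊆P = p⊆p∪q W-A

        P⊆A : P ⊆ A
        P⊆A x∈ with x∈p∪q⁻ S-A W-A x∈
        ... | inj₁ x∈S-A = p∩q⊆q S A x∈S-A
        ... | inj₂ x∈W-A = p∩q⊆q W A x∈W-A

        shuffle : ∀ a b c → a + (b + c) + 3 ≡ a + 3 + b + c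
        shuffle = solve-∀

        split : ∀ {u x} → u ∈ S → x ∈ N⁺ u → x ∈ P ⊎ x ∈ S-B ∪ W-B
        split u∈S x∈ with part (proj₂ (endpoints (∈N⁺⇒⟶ D x∈)))
                        | N⁺⊆N⁺∪N⁺⁺ D (∈N⁺⇒⟶ D u∈S) (∈N⁺⇒⟶ D x∈)
        ... | inj₁ x∈A | inj₁ x∈S = inj₁ (x∈p∪q⁺ (inj₁ (x∈p∩q⁺ (x∈S , x∈A))))
        ... | inj₁ x∈A | inj₂ x∈W = inj₁ (x∈p∪q⁺ (inj₂ (x∈p∩q⁺ (x∈W , x∈A))))
        ... | inj₂ x∈B | inj₁ x∈S = inj₂ (x∈p∪q⁺ (inj₁ (x∈p∩q⁺ (x∈S , x∈B))))
        ... | inj₂ x∈B | inj₂ x∈W = inj₂ (x∈p∪q⁺ (inj₂ (x∈p∩q⁺ (x∈W , x∈B))))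

        out : ∀ {u} → u ∈ S-A → ∣ S ∣ ≤ ∣ N⁺ u ∩ P ∣ + (∣ N⁺ u ∩ S-B ∣ + ∣ N⁺ u ∩ W-B ∣)
        out {u} u∈ = ≤-trans (minimal (S⊆vertices u∈S)) $
          ≤-trans (∣∣-cover {r = N⁺ u ∩ (S-B ∪ W-B)} λ x∈ →
                     Sum.map (λ y → x∈p∩q⁺ (x∈ , y)) (λ y → x∈p∩q⁺ (x∈ , y)) (split u∈S x∈))
                  (+-monoʳ-≤ ∣ N⁺ u ∩ P ∣ (∣∣-cover λ x∈ →
                     let (x∈N , x∈∪) = x∈p∩q⁻ (N⁺ u) (S-B ∪ W-B) x∈ in
                     Sum.map (λ y → x∈p∩q⁺ (x∈N , y)) (λ y → x∈p∩q⁺ (x∈N , y)) (x∈p∪q⁻ S-B W-B x∈∪)))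
          where
          u∈S : u ∈ S
          u∈S = p∩q⊆p S A u∈

      -- The count shared by both cases, where `t` measures the excess of `∣ W-A ∣` over
      -- `∣ S-B ∣ + 1`. Since `W` is smaller than `S`, this excess forces `S-A` to be large, and its
      -- out-arcs then exceed the available bounds.
      #arcs-S-A-S-B≰ : ∀ t → ∣ W-A ∣ ≡ ∣ S-B ∣ + 1 + t → ¬ (#arcs D S-A S-B ≤ ∣ S-B ∣ * t)
      #arcs-S-A-S-B≰ t ∣W-A∣≡ arcs≤ with m≤n⇒∃[o]m+o≡n ∣S-A∣≥
        where
        open ≤-Reasoning
        -- The 2 is one unit from `∣ W ∣ < ∣ S ∣` and one from the `+ 1` in `∣W-A∣≡`. The slack in
        -- this inequality becomes `k`.
        ∣S-A∣≥ : 2 + t + ∣ W-B ∣ ≤ ∣ S-A ∣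
        ∣S-A∣≥ = +-cancelˡ-≤ ∣ S-B ∣ _ _ (begin
          ∣ S-B ∣ + (2 + t + ∣ W-B ∣)    ≡⟨ shuffle (∣ S-B ∣) t (∣ W-B ∣) ⟩
          suc (∣ S-B ∣ + 1 + t + ∣ W-B ∣)  ≡⟨ cong (λ w → suc (w + ∣ W-B ∣)) ∣W-A∣≡ ⟨
          suc (∣ W-A ∣ + ∣ W-B ∣)          ≤⟨ s≤s ∣W∣≥ ⟩
          suc ∣ W ∣                        ≤⟨ small v∈ ⟩
          ∣ S ∣                            ≡⟨ ∣S∣≡ ⟩
          ∣ S-A ∣ + ∣ S-B ∣                ≡⟨ +-comm ∣ S-A ∣ _ ⟩
          ∣ S-B ∣ + ∣ S-A ∣                ∎)
          where
          shuffle : ∀ b t w → b + (2 + t + w) ≡ suc (b + 1 + t + w)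
          shuffle = solve-∀
      ... | k , ∣S-A∣≡ = <⇒≱ (counting-bound t ∣ S-B ∣ ∣ W-B ∣ k) (begin
        a * (a + ∣ S-B ∣) + 3
          ≡⟨ cong (λ a → a * (a + ∣ S-B ∣) + 3) ∣S-A∣≡ ⟩
        ∣ S-A ∣ * (∣ S-A ∣ + ∣ S-B ∣) + 3
          ≡⟨ cong (λ d → ∣ S-A ∣ * d + 3) ∣S∣≡ ⟨
        ∣ S-A ∣ * ∣ S ∣ + 3
          ≤⟨ ∣S-A∣*∣S∣-bound (subst (2 ≤_) ∣S-A∣≡ (s≤s (s≤s z≤n))) ⟩
        2 * (∣ S-A ∣ + ∣ W-A ∣) + #arcs D S-A S-B + ∣ S-A ∣ * ∣ W-B ∣
          ≤⟨ +-monoˡ-≤ (∣ S-A ∣ * ∣ W-B ∣) (+-monoʳ-≤ (2 * (∣ S-A ∣ + ∣ W-A ∣)) arcs≤) ⟩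
        2 * (∣ S-A ∣ + ∣ W-A ∣) + ∣ S-B ∣ * t + ∣ S-A ∣ * ∣ W-B ∣
          ≡⟨ cong₂ (λ a w → 2 * (a + w) + ∣ S-B ∣ * t + a * ∣ W-B ∣) (sym ∣S-A∣≡) ∣W-A∣≡ ⟩
        2 * (a + (∣ S-B ∣ + 1 + t)) + ∣ S-B ∣ * t + a * ∣ W-B ∣ ∎)
        where
        open ≤-Reasoning
        a : ℕ
        a = 2 + t + ∣ W-B ∣ + k

      -- Besides settling one case for the chosen vertex, this is reused for vertices of `B`, whose
      -- out-neighbours always lie in `A`.
      S⊈A : ¬ S ⊆ A
      S⊈A S⊆A = impossible sparse-out-neighbour
        where
        open ≤-Reasoning
        ∣S-B∣≡0 : ∣ S-B ∣ ≡ 0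
        ∣S-B∣≡0 = n<1⇒n≡0 (≰⇒> λ 1≤ → let (x , x∈) = 1≤∣p∣⇒Nonempty S-B 1≤ in
          A∩B (S⊆A (p∩q⊆p S B x∈)) (p∩q⊆q S B x∈))

        W⊆B : W ⊆ B
        W⊆B {x} x∈W with part (N⁺⁺⊆vertices D x∈W)
        ... | inj₂ x∈B = x∈B
        -- A vertex of `W` in `A` makes `∣ W-A ∣` positive, so `t` can be `∣ W-A ∣` minus one; as
        -- `S-B` is empty, no arcs go there.
        ... | inj₁ x∈A with m≤n⇒∃[o]m+o≡n (x∈p⇒1≤∣p∣ (x∈p∩q⁺ {p = W} {q = A} (x∈W , x∈A)))
        ...   | t , 1+t≡ = ⊥-elim (#arcs-S-A-S-B≰ t
          (trans (sym 1+t≡) (cong (λ b → b + 1 + t) (sym ∣S-B∣≡0)))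
          (≤-trans (#arcs-≤-* D S-A S-B) (≤-reflexive (trans
            (cong (∣ S-A ∣ *_) ∣S-B∣≡0)
            (trans (*-zeroʳ ∣ S-A ∣) (cong (_* t) (sym ∣S-B∣≡0)))))))

        sparse-out-neighbour : ∃[ u ] u ∈ S × ∣ N⁺ u ∩ S ∣ ≤ 1
        sparse-out-neighbour with any? (λ u → (u ∈? S) ×-dec (∣ N⁺ u ∩ S ∣ ≤? 1))
        ... | yes found = found
        -- Otherwise every vertex of `S` sends at least two arcs into `S`, against the bound of 2m -
        -- 3.
        ... | no  none  = ⊥-elim (<⇒≱ (m<m+n (#arcs D S S) {3} (s≤s z≤n)) (begin
          #arcs D S S + 3      ≤⟨ #arcs-sparse D deg S⊆A 2≤∣S∣ ⟩
          2 * ∣ S ∣            ≡⟨ *-comm 2 ∣ S ∣ ⟩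
          ∣ S ∣ * 2            ≡⟨ ∑-const S 2 ⟨
          ∑ S (λ _ → 2)        ≤⟨ ∑-mono S many ⟩
          #arcs D S S          ∎))
          where
          many : ∀ {u} → u ∈ S → 2 ≤ ∣ N⁺ u ∩ S ∣
          many {u} u∈S = ≰⇒> λ ≤1 → none (u , u∈S , ≤1)
          2≤∣S∣ : 2 ≤ ∣ S ∣
          2≤∣S∣ = let (u , u∈S) = 1≤∣p∣⇒Nonempty S (≤-trans (s≤s z≤n) (small v∈))
                  in ≤-trans (many u∈S) (∣p∩q∣≤∣q∣ (N⁺ u) S)

        impossible : ¬ (∃[ u ] u ∈ S × ∣ N⁺ u ∩ S ∣ ≤ 1)
        -- The contradiction comes from `s`, the one out-neighbour of `u` in `S`: by minimality
        -- `N⁺ s` has at least `∣ S ∣` elements, yet it fits into `S - s`.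
        impossible (u , u∈S , ≤1) = <⇒≱ (x∈p⇒∣p-x∣<∣p∣ s∈S)
          (≤-trans (minimal (S⊆vertices s∈S)) (p⊆q⇒∣p∣≤∣q∣ N⁺s⊆))
          where
          u∈ : u ∈ vertices
          u∈ = S⊆vertices u∈S

          N⁺u-cover : ∀ {x} → x ∈ N⁺ u → x ∈ N⁺ u ∩ S ⊎ x ∈ W
          N⁺u-cover x∈ with N⁺⊆N⁺∪N⁺⁺ D (∈N⁺⇒⟶ D u∈S) (∈N⁺⇒⟶ D x∈)
          ... | inj₁ x∈S = inj₁ (x∈p∩q⁺ (x∈ , x∈S))
          ... | inj₂ x∈W = inj₂ x∈W

          N⁺u∩S : Nonempty (N⁺ u ∩ S)
          N⁺u∩S = 1≤∣p∣⇒Nonempty (N⁺ u ∩ S) (+-cancelʳ-≤ ∣ W ∣ _ _ (begin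
            1 + ∣ W ∣              ≤⟨ small v∈ ⟩
            ∣ S ∣                  ≤⟨ minimal u∈ ⟩
            ∣ N⁺ u ∣               ≤⟨ ∣∣-cover N⁺u-cover ⟩
            ∣ N⁺ u ∩ S ∣ + ∣ W ∣   ∎))

          s : Fin n
          s = proj₁ N⁺u∩S
          s∈S : s ∈ S
          s∈S = p∩q⊆q (N⁺ u) S (proj₂ N⁺u∩S)

          -- With only one out-neighbour in `S`, `u` cannot afford to miss any vertex of `W`.
          u⟶W : ∀ {w} → w ∈ W → u ⟶ w
          u⟶W {w} w∈W = decidable-stable (u ⟶? w) λ ¬uw → <⇒≱ (small v∈) (begin
            ∣ S ∣                      ≤⟨ minimal u∈ ⟩
            ∣ N⁺ u ∣                   ≤⟨ ∣∣-cover {r = W - w} (λ x∈ → Sum.map₂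
                                            (λ x∈W → x∈p∧x≢y⇒x∈p-y x∈W (λ { refl → ¬uw (∈N⁺⇒⟶ D x∈) }))
                                            (N⁺u-cover x∈)) ⟩
            ∣ N⁺ u ∩ S ∣ + ∣ W - w ∣   ≤⟨ +-monoˡ-≤ ∣ W - w ∣ ≤1 ⟩
            1 + ∣ W - w ∣              ≡⟨ x∈p⇒∣p∣≡1+∣p-x∣ w∈W ⟨
            ∣ W ∣                      ∎)

          s↛W : ∀ {w} → w ∈ W → ¬ s ⟶ w
          s↛W {w} w∈W sw = <⇒≱ (small u∈) (begin
            ∣ N⁺ u ∣              ≤⟨ ∣∣-cover N⁺u-cover ⟩
            ∣ N⁺ u ∩ S ∣ + ∣ W ∣  ≤⟨ +-monoˡ-≤ ∣ W ∣ ≤1 ⟩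
            1 + ∣ W ∣             ≤⟨ small v∈ ⟩
            ∣ S ∣                 ≤⟨ minimal (N⁺⁺⊆vertices D w∈W) ⟩
            ∣ N⁺ w ∣              ≤⟨ p⊆q⇒∣p∣≤∣q∣ sub ⟩
            ∣ N⁺⁺ u ∣             ∎)
            where
            sub : N⁺ w ⊆ N⁺⁺ u
            -- The path from `u` through `w` to `y` puts `y` in `N⁺⁺ u` unless `u ⟶ y`. Then either
            -- `y` is `s`, giving a digon with `w`, or `y` lies in `W`, giving an arc inside `B`.
            sub {y} y∈ = ∈N⁺⁺ D (u⟶W w∈W) wy λ uy → case (N⁺u-cover (⟶⇒∈N⁺ D uy))
              where
              wy : w ⟶ y
              wy = ∈N⁺⇒⟶ D y∈
              case : ¬ (y ∈ N⁺ u ∩ S ⊎ y ∈ W)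
              case (inj₁ y∈) with refl ← ∣p∣≤1⇒x≡y ≤1 y∈ (proj₂ N⁺u∩S) = digonless sw wy
              case (inj₂ y∈W) = A∩B (B⟶A (W⊆B w∈W) wy) (W⊆B y∈W)

          N⁺s⊆ : N⁺ s ⊆ S - s
          N⁺s⊆ {y} y∈ with N⁺⊆N⁺∪N⁺⁺ D (∈N⁺⇒⟶ D s∈S) (∈N⁺⇒⟶ D y∈)
          ... | inj₁ y∈S = x∈p∧x≢y⇒x∈p-y y∈S (λ y≡s → loopless (sym y≡s) (∈N⁺⇒⟶ D y∈))
          ... | inj₂ y∈W = ⊥-elim (s↛W y∈W (∈N⁺⇒⟶ D y∈))

    -- If `N⁺ v` meets `B`, bounding the arcs into each vertex of `S-B` reduces this case to
    -- `#arcs-S-A-S-B≰`.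
    no-minimal : ∀ {v} → v ∈ vertices → ¬ (∀ {u} → u ∈ vertices → ∣ N⁺ v ∣ ≤ ∣ N⁺ u ∣)
    no-minimal {v} v∈ minimal with nonempty? (N⁺ v ∩ B)
    ... | no N⁺∩B≡∅ = S⊈A v∈ minimal λ {x} x∈ → case part (proj₂ (endpoints (∈N⁺⇒⟶ D x∈))) of λ
      { (inj₁ x∈A) → x∈A
      ; (inj₂ x∈B) → ⊥-elim (N⁺∩B≡∅ (x , x∈p∩q⁺ (x∈ , x∈B))) }
    ... | yes (x₀ , x₀∈) = #arcs-S-A-S-B≰ v∈ minimal t ∣W-A∣≡ arcs≤
      where
      open ≤-Reasoning
      S S-A S-B W-A : Subset n
      S   = N⁺ v
      S-A = S ∩ A
      S-B = S ∩ B
      W-A = N⁺⁺ v ∩ A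

      -- Otherwise `x` would also have minimum out-degree, with all out-neighbours in `A`, contrary
      -- to `S⊈A`.
      ∣S∣< : ∀ {x} → x ∈ B → x ∈ vertices → ∣ S ∣ < ∣ N⁺ x ∣
      ∣S∣< x∈B x∈ = ≰⇒> λ ≤S → S⊈A x∈ (≤-trans ≤S ∘ minimal) (B⟶A x∈B ∘ ∈N⁺⇒⟶ D)

      -- Out-neighbours of `x` lie in `S-A` or `W-A`, and those in `S-A` are disjoint from its
      -- in-neighbours there. A large out-degree therefore leaves little room for arcs into `x`.
      in-bound : ∀ {x} → x ∈ S-B → ∣ N⁻ x ∩ S-A ∣ + suc ∣ S ∣ ≤ ∣ S-A ∣ + ∣ W-A ∣
      in-bound {x} x∈ = begin
        ∣ N⁻ x ∩ S-A ∣ + suc ∣ S ∣                   ≤⟨ +-monoʳ-≤ _ (∣S∣< x∈B (proj₂ (endpoints vx))) ⟩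
        ∣ N⁻ x ∩ S-A ∣ + ∣ N⁺ x ∣                    ≤⟨ +-monoʳ-≤ _ (∣∣-cover out) ⟩
        ∣ N⁻ x ∩ S-A ∣ + (∣ N⁺ x ∩ S-A ∣ + ∣ W-A ∣)  ≡⟨ +-assoc ∣ N⁻ x ∩ S-A ∣ _ _ ⟨
        ∣ N⁻ x ∩ S-A ∣ + ∣ N⁺ x ∩ S-A ∣ + ∣ W-A ∣    ≤⟨ +-monoˡ-≤ ∣ W-A ∣ in+out ⟩
        ∣ S-A ∣ + ∣ W-A ∣                            ∎
        where
        x∈B : x ∈ B
        x∈B = p∩q⊆q S B x∈
        vx : v ⟶ x
        vx = ∈N⁺⇒⟶ D (p∩q⊆p S B x∈)

        out : ∀ {y} → y ∈ N⁺ x → y ∈ N⁺ x ∩ S-A ⊎ y ∈ W-A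
        out y∈ with N⁺⊆N⁺∪N⁺⁺ D vx (∈N⁺⇒⟶ D y∈) | B⟶A x∈B (∈N⁺⇒⟶ D y∈)
        ... | inj₁ y∈S | y∈A = inj₁ (x∈p∩q⁺ (y∈ , x∈p∩q⁺ (y∈S , y∈A)))
        ... | inj₂ y∈W | y∈A = inj₂ (x∈p∩q⁺ (y∈W , y∈A))

        in+out : ∣ N⁻ x ∩ S-A ∣ + ∣ N⁺ x ∩ S-A ∣ ≤ ∣ S-A ∣
        in+out = ∣∣-pack (p∩q⊆q (N⁻ x) S-A) (p∩q⊆q (N⁺ x) S-A) λ y∈⁻ y∈⁺ → digonless
          (∈N⁻⇒⟶ D (p∩q⊆p (N⁻ x) S-A y∈⁻)) (∈N⁺⇒⟶ D (p∩q⊆p (N⁺ x) S-A y∈⁺))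

      -- The number of arcs a vertex of S-B can receive from S-A; the
      -- subtraction is not truncated, since S-B contains x₀.
      t : ℕ
      t = ∣ S-A ∣ + ∣ W-A ∣ ∸ suc ∣ S ∣

      -- Splitting `∣ S ∣` shows that the bound on arcs into a vertex of `S-B` is also the excess
      -- required by `#arcs-S-A-S-B≰`.
      ∣W-A∣≡ : ∣ W-A ∣ ≡ ∣ S-B ∣ + 1 + t
      ∣W-A∣≡ = +-cancelˡ-≡ ∣ S-A ∣ _ _ (begin-equality
        ∣ S-A ∣ + ∣ W-A ∣                  ≡⟨ m∸n+n≡m (m+n≤o⇒n≤o ∣ N⁻ x₀ ∩ S-A ∣ (in-bound x₀∈)) ⟨
        t + suc ∣ S ∣                      ≡⟨ cong (λ d → t + suc d) (∣S∣≡ v∈ minimal) ⟩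
        t + suc (∣ S-A ∣ + ∣ S-B ∣)        ≡⟨ shuffle t ∣ S-A ∣ ∣ S-B ∣ ⟩
        ∣ S-A ∣ + (∣ S-B ∣ + 1 + t)        ∎)
        where
        shuffle : ∀ t a b → t + suc (a + b) ≡ a + (b + 1 + t)
        shuffle = solve-∀

      arcs≤ : #arcs D S-A S-B ≤ ∣ S-B ∣ * t
      arcs≤ = begin
        #arcs D S-A S-B                ≡⟨ #arcs-in D S-A S-B ⟩
        ∑ S-B (λ x → ∣ N⁻ x ∩ S-A ∣)   ≤⟨ ∑-mono S-B (λ x∈ → m+n≤o⇒m≤o∸n _ (in-bound x∈)) ⟩
        ∑ S-B (λ _ → t)                ≡⟨ ∑-const S-B t ⟩
        ∣ S-B ∣ * t                    ∎

theorem2 : (n : ℕ) (D : OrientedGraph n) (A B : Subset n) →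
    Nonempty (OrientedGraph.vertices D) →
    IsPartition (OrientedGraph.vertices D) A B →
    OrientedGraph.Independent D B →
    TwoDegenerate (induced D A) →
    ∃[ v ] v ∈ OrientedGraph.vertices D × OrientedGraph.LargeSecondNeighborhood D v
theorem2 n D A B V≢∅ A∪B indep deg with any? large?
  where
  open OrientedGraph D
  large? : U.Decidable (λ v → v ∈ vertices × LargeSecondNeighborhood v)
  large? v = (v ∈? vertices) ×-dec (∣ N⁺ v ∣ ≤? ∣ N⁺⁺ v ∣)
... | yes found = found
-- The failed search makes every vertex small, so a vertex of minimum out-degree yields the
-- contradiction.
... | no  none  =
  let (v , v∈ , minimal) = argmin (∣_∣ ∘ OrientedGraph.N⁺ D) V≢∅
  in ⊥-elim (no-minimal D A∪B indep deg (λ {u} u∈ → ≰⇒> λ le → none (u , u∈ , le)) v∈ minimal)
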